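{- For all positive integers $m,n$, the domination polynomial $D(K_m \,\square\, K_n, x)$ is unimodal.
   Context: For a finite simple graph $G$, a set $U \subseteq V(G)$ is dominating if every vertex is in $U$ or adjacent to a vertex of $U$; $d_i(G)$ is the number of dominating sets of size $i$ and $D(G,x)=\sum_{i} d_i(G)x^i$ is the domination polynomial. A polynomial is unimodal if its coefficients (ordered by increasing power of $x$) are non-decreasing and then non-increasing. $K_n$ is the complete graph on $n$ vertices. The Cartesian product $G\,\square\, H$ has vertex set $V(G)\times V(H)$, with $(g,h)$ adjacent to $(g',h')$ iff either $g=g'$ and $\{h,h'\}\in E(H)$, or $\{g,g'\}\in E(G)$ and $h=h'$. -}

module Defs where

open import Data.Nat using (ℕ; zero; suc; _≤_; _*_)
open import Data.Bool using (Bool; true; false; _∧_; _∨_; not)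
open import Data.Fin using (Fin; remQuot)
open import Data.Fin.Properties using (_≟_)
open import Data.Fin.Subset using (Subset; inside; outside)
open import Data.Vec using (Vec; []; _∷_; map; _++_; lookup; count)
open import Data.List using (List; []; _∷_; length; filterᵇ; allFin)
open import Data.Nat using () renaming (_≟_ to _ℕ≟_)
open import Data.List.Relation.Unary.Any using (Any)
open import Data.List using () renaming (map to lmap; _++_ to _l++_)
open import Data.Product using (_×_; _,_; ∃; proj₁; proj₂)
open import Relation.Nullary using (¬_; does)
open import Relation.Binary.PropositionalEquality using (_≡_)
open import Data.Fin.Subset using (_∈_)

record Graph (N : ℕ) : Set where
  field
    adj       : Fin N → Fin N → Bool
    adj-sym   : ∀ u v → adj u v ≡ adj v u
    adj-irref : ∀ v → adj v v ≡ false
open Graph public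

K : (n : ℕ) → Graph n
K n = record
  { adj = λ u v → not (does (u ≟ v))
  ; adj-sym = sym'
  ; adj-irref = irr }
  where
  open import Relation.Binary.PropositionalEquality using (refl; sym)
  open import Relation.Nullary using (yes; no)
  sym' : ∀ u v → not (does (u ≟ v)) ≡ not (does (v ≟ u))
  sym' u v with u ≟ v | v ≟ u
  ... | yes _ | yes _ = refl
  ... | no _  | no _  = refl
  ... | yes p | no q  = Data.Empty.⊥-elim (q (sym p)) where import Data.Empty
  ... | no p  | yes q = Data.Empty.⊥-elim (p (sym q)) where import Data.Empty
  irr : ∀ v → not (does (v ≟ v)) ≡ false
  irr v with v ≟ v
  ... | yes _ = refl
  ... | no ¬p = Data.Empty.⊥-elim (¬p refl) where import Data.Empty

_□_ : ∀ {m n} → Graph m → Graph n → Graph (m * n)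
_□_ {m} {n} G H = record
  { adj = adj□
  ; adj-sym = sym□
  ; adj-irref = irr□ }
  where
  open import Relation.Binary.PropositionalEquality using (refl; sym; cong₂)
  open import Relation.Nullary using (yes; no)
  adj' : Fin m × Fin n → Fin m × Fin n → Bool
  adj' (g , h) (g' , h') =
    (does (g ≟ g') ∧ adj H h h') ∨ (adj G g g' ∧ does (h ≟ h'))
  adj□ : Fin (m * n) → Fin (m * n) → Bool
  adj□ u v = adj' (remQuot n u) (remQuot n v)
  deq-sym : ∀ {k} (a b : Fin k) → does (a ≟ b) ≡ does (b ≟ a)
  deq-sym a b with a ≟ b | b ≟ a
  ... | yes _ | yes _ = refl
  ... | no _  | no _  = refl
  ... | yes p | no q  = Data.Empty.⊥-elim (q (sym p)) where import Data.Empty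
  ... | no p  | yes q = Data.Empty.⊥-elim (p (sym q)) where import Data.Empty
  sym' : ∀ p q → adj' p q ≡ adj' q p
  sym' (g , h) (g' , h') =
    cong₂ _∨_ (cong₂ _∧_ (deq-sym g g') (adj-sym H h h'))
              (cong₂ _∧_ (adj-sym G g g') (deq-sym h h'))
  sym□ : ∀ u v → adj□ u v ≡ adj□ v u
  sym□ u v = sym' (remQuot n u) (remQuot n v)
  irr' : ∀ p → adj' p p ≡ false
  irr' (g , h) with g ≟ g | h ≟ h
  ... | yes _ | yes _ rewrite adj-irref H h | adj-irref G g = refl
  ... | no ¬p | _ = Data.Empty.⊥-elim (¬p refl) where import Data.Empty
  ... | _ | no ¬p = Data.Empty.⊥-elim (¬p refl) where import Data.Empty
  irr□ : ∀ v → adj□ v v ≡ false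
  irr□ v = irr' (remQuot n v)

isDominating : ∀ {N} → Graph N → Subset N → Bool
isDominating {N} G U = all' (allFin N)
  where
  inU : Fin N → Bool
  inU v with lookup U v
  ... | inside = true
  ... | outside = false
  any' : List (Fin N) → (Fin N → Bool) → Bool
  any' [] p = false
  any' (x ∷ xs) p = p x ∨ any' xs p
  covered : Fin N → Bool
  covered v = inU v ∨ any' (allFin N) (λ u → inU u ∧ adj G u v)
  all' : List (Fin N) → Bool
  all' [] = true
  all' (x ∷ xs) = covered x ∧ all' xs

allSubsets : (N : ℕ) → List (Subset N)
allSubsets zero = [] ∷ []
allSubsets (suc N) =
  lmap (inside ∷_) (allSubsets N) l++ lmap (outside ∷_) (allSubsets N)

size : ∀ {N} → Subset N → ℕ
size [] = 0
size (inside ∷ U) = suc (size U)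
size (outside ∷ U) = size U

-- d_i(G): number of dominating sets of G of size i
-- (the i-th coefficient of the domination polynomial D(G,x)).
d : ∀ {N} → Graph N → ℕ → ℕ
d {N} G i = length (filterᵇ (λ U → does (size U ℕ≟ i) ∧ isDominating G U) (allSubsets N))

Unimodal : (ℕ → ℕ) → Set
Unimodal a = ∃ λ k → (∀ i → i Data.Nat.< k → a i ≤ a (suc i))
                   × (∀ i → k ≤ i → a (suc i) ≤ a i)
  where import Data.Nat

DomPolyUnimodal : ∀ {N} → Graph N → Set
DomPolyUnimodal G = Unimodal (d G)

{-# OPTIONS --safe #-}

-- Write N = mn. Supersets of dominating sets dominate, so double counting inclusions
-- between consecutive layers makes the coefficients non-decreasing up to N/2. Above N/2,
-- a non-dominating set misses the closed neighbourhood of some vertex v, that is, lies in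
-- the (m-1)(n-1)-element set of vertices sharing neither coordinate with v. So at most
-- N·C((m-1)(n-1), i) of the i-sets are non-dominating, and for i ≥ N/2 this is at most
-- C(N, i) − C(N, i+1), because C(k+M, i) ≥ 2ᵏ C(M, i) whenever k + M ≤ 2i. With
-- k = m+n-1 this needs N(N+2) ≤ 2^(m+n), which fails only for a few small grids; those
-- are treated directly (in a grid of width at most 2, no i ≥ N/2 is at most (m-1)(n-1)).
module Submission where

open import Defs
open import Data.Bool using (Bool; true; false; _∧_; _∨_; not; T; if_then_else_)
open import Data.Bool.ListAction using (all; any)
open import Data.Bool.Properties using (T?; T-∧; T-∨)
open import Data.Empty using (⊥-elim)
open import Data.Fin using (Fin; zero; suc; combine; quotient; remainder)
open import Data.Fin.Properties using (_≟_; any?; ¬∀⟶∃¬; combine-remQuot)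
open import Data.Fin.Subset using (Subset; inside; outside; _∈_; _⊆_; ∁; ⁅_⁆; ⊥; ∣_∣)
open import Data.Fin.Subset.Properties
  using (_∈?_; _⊆?_; s⊆s; out⊆; drop-∷-⊆; x∉p⇒x∈∁p; x∈⁅y⁆⇒x≡y; ∣∁p∣≡n∸∣p∣; ∣⁅x⁆∣≡1; ∣⊥∣≡0)
open import Data.List using (List; []; _∷_; length; map; _++_; filterᵇ; allFin)
open import Data.List.Membership.Propositional using (lose)
open import Data.List.Membership.Propositional.Properties using (∈-allFin)
open import Data.List.Properties using (filter-++; length-++; length-tabulate)
import Data.List.Relation.Unary.All as All
open import Data.List.Relation.Unary.All.Properties using (all⁺; all⁻; tabulate⁺)
open import Data.List.Relation.Unary.Any using (satisfied)
open import Data.List.Relation.Unary.Any.Properties using (any⁺; any⁻)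
open import Data.Nat using (ℕ; zero; suc; _+_; _*_; _∸_; _^_; _≤_; _<_; z≤n; s≤s; z<s; ⌊_/2⌋; ⌈_/2⌉)
  renaming (_≟_ to _≟ℕ_)
open import Data.Nat.Combinatorics using (_C_; nCk+nC[k+1]≡[n+1]C[k+1])
open import Data.Nat.Combinatorics.Specification using (k>n⇒nCk≡0)
open import Data.Nat.Properties hiding (_≟_)
open import Data.Nat.Tactic.RingSolver using (solve-∀)
open import Data.Product using (_×_; _,_; ∃; proj₁; proj₂; uncurry)
open import Data.Sum using (_⊎_; inj₁; inj₂)
import Data.Sum as Sum
import Data.Vec as Vec
open import Data.Vec using ([]; _∷_; lookup)
open import Data.Vec.Properties using ([]=⇒lookup; lookup⇒[]=; lookup-concat; lookup-map)
open import Function.Base using (_∘_; const; id)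
open import Function.Bundles using (_⇔_; mk⇔; module Equivalence)
open import Relation.Binary.PropositionalEquality
  using (_≡_; _≢_; refl; sym; trans; cong; cong₂; subst; subst₂; module ≡-Reasoning)
open import Relation.Nullary using (¬_; Dec; yes; no; does; contradiction)
open import Relation.Nullary.Decidable using (isYes; _⊎-dec_; _×-dec_; _→-dec_; fromWitness; toWitness)

open Equivalence using (to; from)

-- Domination

module _ {A : Set} where

  -- `f` stays abstract because the helpers inside `isDominating` are reachable only through their
  -- recursion equations, which already pin them down.
  foldr-∧≡all : (c : A → Bool) (f : List A → Bool) → f [] ≡ true →
                (∀ x xs → f (x ∷ xs) ≡ c x ∧ f xs) → ∀ xs → f xs ≡ all c xs
  foldr-∧≡all c f base step []       = base
  foldr-∧≡all c f base step (x ∷ xs) =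
    trans (step x xs) (cong (c x ∧_) (foldr-∧≡all c f base step xs))

  foldr-∨≡any : (c : A → Bool) (f : List A → Bool) → f [] ≡ false →
                (∀ x xs → f (x ∷ xs) ≡ c x ∨ f xs) → ∀ xs → f xs ≡ any c xs
  foldr-∨≡any c f base step []       = base
  foldr-∨≡any c f base step (x ∷ xs) =
    trans (step x xs) (cong (c x ∨_) (foldr-∨≡any c f base step xs))

T-lookup : ∀ {N} (U : Subset N) v → T (lookup U v) ⇔ v ∈ U
T-lookup U v = mk⇔ (fwd (lookup U v) refl) (λ v∈U → subst T (sym ([]=⇒lookup v∈U)) _)
  where
  fwd : ∀ b → lookup U v ≡ b → T b → v ∈ U
  fwd true eq _ = lookup⇒[]= v U eq

module _ {N} (G : Graph N) where

  Dominates : Subset N → Fin N → Set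
  Dominates U v = v ∈ U ⊎ ∃ λ u → u ∈ U × T (adj G u v)

  dominates? : ∀ U v → Dec (Dominates U v)
  dominates? U v = (v ∈? U) ⊎-dec any? (λ u → (u ∈? U) ×-dec T? (adj G u v))

  Dominates-mono : ∀ {U V v} → U ⊆ V → Dominates U v → Dominates V v
  Dominates-mono U⊆V (inj₁ v∈U)           = inj₁ (U⊆V v∈U)
  Dominates-mono U⊆V (inj₂ (u , u∈U , e)) = inj₂ (u , U⊆V u∈U , e)

  -- The helpers local to isDominating cannot be named from outside; here they are
  -- recovered as the metavariable solutions of the equations they satisfy.
  module _ (U : Subset N) where

    isDominating-fold : ∃ λ (f : List (Fin N) → Bool) → isDominating G U ≡ f (allFin N)
    isDominating-fold = f , unfolded
      where
      f : List (Fin N) → Bool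
      f = _
      unfolded : isDominating G U ≡ f (allFin N)
      -- Once the list is a variable, comparing the two sides solves `f` by pattern unification.
      unfolded with allFin N
      ... | _ = refl

    isDominating-step : ∃ λ (c : Fin N → Bool) → ∀ v vs →
      proj₁ isDominating-fold (v ∷ vs) ≡ c v ∧ proj₁ isDominating-fold vs
    isDominating-step = c , λ _ _ → refl
      where
      c : Fin N → Bool
      c = _

    covered : Fin N → Bool
    covered = proj₁ isDominating-step

    isDominating-all : isDominating G U ≡ all covered (allFin N)
    isDominating-all = trans (proj₂ isDominating-fold)
      (foldr-∧≡all covered (proj₁ isDominating-fold) refl (proj₂ isDominating-step) (allFin N))

    covered-fold : ∃ λ (f : Fin N → List (Fin N) → Bool) →
      ∀ v → covered v ≡ lookup U v ∨ f v (allFin N)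
    covered-fold = f , unfolded
      where
      f : Fin N → List (Fin N) → Bool
      f = _
      unfolded : ∀ v → covered v ≡ lookup U v ∨ f v (allFin N)
      unfolded v with lookup U v | allFin N
      -- Here the disjunction reduces to its second part, which determines `f`; in the `true` case
      -- both sides are `true`.
      ... | false | _ = refl
      ... | true  | _ = refl

    covered-any : ∀ v →
      covered v ≡ lookup U v ∨ any (λ u → lookup U u ∧ adj G u v) (allFin N)
    covered-any v = trans (proj₂ covered-fold v)
      (cong (lookup U v ∨_)
        (foldr-∨≡any _ (proj₁ covered-fold v) refl step (allFin N)))
      where
      step : ∀ u us → proj₁ covered-fold v (u ∷ us)
                    ≡ (lookup U u ∧ adj G u v) ∨ proj₁ covered-fold v us
      step u us with lookup U u
      ... | true  = refl
      ... | false = refl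

    covered-⇔ : ∀ v → T (covered v) ⇔ Dominates U v
    covered-⇔ v = mk⇔ fwd (subst T (sym (covered-any v)) ∘ bwd)
      where
      fwd : T (covered v) → Dominates U v
      fwd t with to T-∨ (subst T (covered-any v) t)
      ... | inj₁ t₁ = inj₁ (to (T-lookup U v) t₁)
      ... | inj₂ t₂ with satisfied (any⁻ _ (allFin N) t₂)
      ...   | u , tu with to T-∧ tu
      ...     | t∈ , e = inj₂ (u , to (T-lookup U u) t∈ , e)
      bwd : Dominates U v → T (lookup U v ∨ any (λ u → lookup U u ∧ adj G u v) (allFin N))
      bwd (inj₁ v∈U)           = from T-∨ (inj₁ (from (T-lookup U v) v∈U))
      bwd (inj₂ (u , u∈U , e)) = from (T-∨ {lookup U v}) (inj₂
        (any⁺ _ (lose (∈-allFin u) (from T-∧ (from (T-lookup U u) u∈U , e)))))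

    isDominating-⇔ : T (isDominating G U) ⇔ (∀ v → Dominates U v)
    isDominating-⇔ = mk⇔
      (λ t v → to (covered-⇔ v)
        (All.lookup (all⁺ covered (allFin N) (subst T isDominating-all t)) (∈-allFin v)))
      (λ dom → subst T (sym isDominating-all)
        (all⁻ covered (tabulate⁺ (λ v → from (covered-⇔ v) (dom v)))))

    -- There are finitely many vertices and domination of each is decidable, so a witness can be
    -- searched for.
    undominated : T (not (isDominating G U)) → ∃ λ v → ¬ Dominates U v
    undominated t = ¬∀⟶∃¬ N (Dominates U) (dominates? U)
      (λ dom → T-not (isDominating G U) t (from isDominating-⇔ dom))
      where
      T-not : ∀ b → T (not b) → ¬ T b
      T-not false _ ()

-- Counting the members of a family of subsets layer by layer

-- Splitting on the first vertex makes the recursion follow Pascal's rule, so the counting facts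
-- below become inductions on `N`.
layer : ∀ {N} → (Subset N → Bool) → ℕ → ℕ
layer {zero}  p zero    = if p [] then 1 else 0
layer {zero}  p (suc i) = 0
layer {suc N} p zero    = layer (p ∘ (outside ∷_)) zero
layer {suc N} p (suc i) = layer (p ∘ (inside ∷_)) i + layer (p ∘ (outside ∷_)) (suc i)

length-filterᵇ-map : ∀ {A B : Set} (q : B → Bool) (f : A → B) xs →
                     length (filterᵇ q (map f xs)) ≡ length (filterᵇ (q ∘ f) xs)
length-filterᵇ-map q f []       = refl
length-filterᵇ-map q f (x ∷ xs) with q (f x)
... | true  = cong suc (length-filterᵇ-map q f xs)
... | false = length-filterᵇ-map q f xs

length-filterᵇ-none : ∀ {A : Set} (xs : List A) → length (filterᵇ (const false) xs) ≡ 0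
length-filterᵇ-none []       = refl
length-filterᵇ-none (x ∷ xs) = length-filterᵇ-none xs

length-filterᵇ-layer : ∀ N (p : Subset N → Bool) i →
  length (filterᵇ (λ U → does (size U ≟ℕ i) ∧ p U) (allSubsets N)) ≡ layer p i
length-filterᵇ-layer zero p zero with p []
... | true  = refl
... | false = refl
length-filterᵇ-layer zero p (suc i) = refl
length-filterᵇ-layer (suc N) p i =
  trans (cong length (filter-++ (T? ∘ q) ins outs))
    (trans (length-++ (filterᵇ q ins))
      (trans (cong₂ _+_ (length-filterᵇ-map q (inside ∷_) (allSubsets N))
                        (length-filterᵇ-map q (outside ∷_) (allSubsets N)))
             (split i)))
  where
  q : Subset (suc N) → Bool
  q U = does (size U ≟ℕ i) ∧ p U
  ins outs : List (Subset (suc N))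
  ins  = map (inside ∷_) (allSubsets N)
  outs = map (outside ∷_) (allSubsets N)
  split : ∀ i →
    length (filterᵇ (λ U → does (suc (size U) ≟ℕ i) ∧ p (inside ∷ U)) (allSubsets N)) +
    length (filterᵇ (λ U → does (size U ≟ℕ i) ∧ p (outside ∷ U)) (allSubsets N))
    ≡ layer p i
  split zero    = cong₂ _+_ (length-filterᵇ-none (allSubsets N)) (length-filterᵇ-layer N _ zero)
  split (suc i) = cong₂ _+_ (length-filterᵇ-layer N _ i) (length-filterᵇ-layer N _ (suc i))

layer-mono : ∀ {N} {p q : Subset N → Bool} → (∀ U → T (p U) → T (q U)) →
             ∀ i → layer p i ≤ layer q i
layer-mono {zero} {p} {q} p⇒q zero with p [] | q [] | p⇒q []
... | true  | true  | _ = ≤-refl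
... | true  | false | h = ⊥-elim (h _)
... | false | _     | _ = z≤n
layer-mono {zero}  p⇒q (suc i) = z≤n
layer-mono {suc N} p⇒q zero    = layer-mono (λ U → p⇒q (outside ∷ U)) zero
layer-mono {suc N} p⇒q (suc i) =
  +-mono-≤ (layer-mono (λ U → p⇒q (inside ∷ U)) i) (layer-mono (λ U → p⇒q (outside ∷ U)) (suc i))

layer-none : ∀ N i → layer {N} (const false) i ≡ 0
layer-none zero    zero    = refl
layer-none zero    (suc i) = refl
layer-none (suc N) zero    = layer-none N zero
layer-none (suc N) (suc i) = cong₂ _+_ (layer-none N i) (layer-none N (suc i))

layer-empty : ∀ {N} {p : Subset N → Bool} → (∀ U → ¬ T (p U)) → ∀ i → layer p i ≡ 0
layer-empty {N} {p} ¬p i = n≤0⇒n≡0 (subst (layer p i ≤_) (layer-none N i) (layer-mono ¬p i))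

+-interchange : ∀ a b c e → (a + b) + (c + e) ≡ (a + c) + (b + e)
+-interchange = solve-∀

layer-∨ : ∀ {N} (p q : Subset N → Bool) i →
          layer (λ U → p U ∨ q U) i ≤ layer p i + layer q i
layer-∨ {zero} p q zero with p [] | q []
... | true  | _     = m≤m+n 1 _
... | false | _     = ≤-refl
layer-∨ {zero}  p q (suc i) = z≤n
layer-∨ {suc N} p q zero    = layer-∨ (p ∘ (outside ∷_)) (q ∘ (outside ∷_)) zero
layer-∨ {suc N} p q (suc i) = ≤-trans
  (+-mono-≤ (layer-∨ (p ∘ (inside ∷_)) (q ∘ (inside ∷_)) i)
            (layer-∨ (p ∘ (outside ∷_)) (q ∘ (outside ∷_)) (suc i)))
  (≤-reflexive (+-interchange (layer (p ∘ (inside ∷_)) i) _ _ _))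

-- Union bound, by iterating `layer-∨` along the list.
layer-any : ∀ {N} {A : Set} (q : A → Subset N → Bool) {B} i → (∀ v → layer (q v) i ≤ B) →
            ∀ vs → layer (λ U → any (λ v → q v U) vs) i ≤ length vs * B
layer-any {N} q i q≤B []       = ≤-reflexive (layer-none N i)
layer-any     q i q≤B (v ∷ vs) =
  ≤-trans (layer-∨ (q v) _ i) (+-mono-≤ (q≤B v) (layer-any q i q≤B vs))

layer-not : ∀ {N} (p : Subset N → Bool) i → layer p i + layer (not ∘ p) i ≡ N C i
layer-not {zero} p zero with p []
... | true  = refl
... | false = refl
layer-not {zero}  p (suc i) = refl
layer-not {suc N} p zero    = layer-not (p ∘ (outside ∷_)) zero
layer-not {suc N} p (suc i) = begin
  (a + b) + (c + e)  ≡⟨ +-interchange a b c e ⟩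
  (a + c) + (b + e)  ≡⟨ cong₂ _+_ (layer-not (p ∘ (inside ∷_)) i)
                                   (layer-not (p ∘ (outside ∷_)) (suc i)) ⟩
  N C i + N C suc i  ≡⟨ nCk+nC[k+1]≡[n+1]C[k+1] N i ⟩
  suc N C suc i      ∎
  where
  open ≡-Reasoning
  a b c e : ℕ
  a = layer (p ∘ (inside ∷_)) i
  b = layer (p ∘ (outside ∷_)) (suc i)
  c = layer (not ∘ p ∘ (inside ∷_)) i
  e = layer (not ∘ p ∘ (outside ∷_)) (suc i)

layer≤C : ∀ {N} (p : Subset N → Bool) i → layer p i ≤ N C i
layer≤C p i = subst (layer p i ≤_) (layer-not p i) (m≤m+n _ _)

-- A vertex of `S` contributes one step of Pascal's rule; a vertex outside `S` empties the branch of
-- sets containing it.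
layer-⊆ : ∀ {N} {q : Subset N → Bool} (S : Subset N) → (∀ U → T (q U) → U ⊆ S) →
          ∀ i → layer q i ≤ ∣ S ∣ C i
layer-⊆ []            q⊆S i    = layer≤C _ i
layer-⊆ (inside ∷ S)  q⊆S zero = layer-⊆ S (λ U → drop-∷-⊆ ∘ q⊆S (outside ∷ U)) zero
layer-⊆ (inside ∷ S)  q⊆S (suc i) =
  subst (_ ≤_) (nCk+nC[k+1]≡[n+1]C[k+1] ∣ S ∣ i)
    (+-mono-≤ (layer-⊆ S (λ U → drop-∷-⊆ ∘ q⊆S (inside ∷ U)) i)
              (layer-⊆ S (λ U → drop-∷-⊆ ∘ q⊆S (outside ∷ U)) (suc i)))
layer-⊆ (outside ∷ S) q⊆S zero = layer-⊆ S (λ U → drop-∷-⊆ ∘ q⊆S (outside ∷ U)) zero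
layer-⊆ {q = q} (outside ∷ S) q⊆S (suc i) =
  subst (λ x → x + layer (q ∘ (outside ∷_)) (suc i) ≤ ∣ S ∣ C suc i)
    (sym (layer-empty no-inside i))
    (layer-⊆ S (λ U → drop-∷-⊆ ∘ q⊆S (outside ∷ U)) (suc i))
  where
  no-inside : ∀ U → ¬ T (q (inside ∷ U))
  no-inside U t with q⊆S (inside ∷ U) t Vec.here
  ... | ()

-- Up-closed families

UpClosed : ∀ {N} → (Subset N → Bool) → Set
UpClosed p = ∀ {U V} → U ⊆ V → T (p U) → T (p V)

out⇒in : ∀ {N} {p : Subset (suc N) → Bool} → UpClosed p →
         ∀ U → T (p (outside ∷ U)) → T (p (inside ∷ U))
out⇒in up U = up (out⊆ id)

-- Double counting of inclusions: each member of size `i` has `r` supersets of size `i + 1`, all in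
-- the family, and each set of size `i + 1` has `i + 1` subsets of size `i`.
layer-upClosed : ∀ {N} {p : Subset N → Bool} → UpClosed p → ∀ i r → i + r ≡ N →
                 r * layer p i ≤ suc i * layer p (suc i)
layer-upClosed up i zero eq = z≤n
layer-upClosed {p = p} up zero (suc r) refl = begin
  a + r * a    ≤⟨ +-mono-≤ (layer-mono (out⇒in up) zero)
                            (layer-upClosed (up ∘ s⊆s) zero r refl) ⟩
  b + (c + 0)  ≡⟨ shape b c ⟩
  b + c + 0    ∎
  where
  open ≤-Reasoning
  a b c : ℕ
  a = layer (p ∘ (outside ∷_)) zero
  b = layer (p ∘ (inside ∷_)) zero
  c = layer (p ∘ (outside ∷_)) 1
  shape : ∀ b c → b + (c + 0) ≡ b + c + 0
  shape = solve-∀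
layer-upClosed {p = p} up (suc i) (suc r) refl = begin
  suc r * (a + b)                                  ≡⟨ shapeˡ r a b ⟩
  -- The separate `b` counts the inclusions in which the first vertex is the one added; adding it
  -- sends those sets into the family counted by `c`.
  suc r * a + (r * b + b)                          ≤⟨ +-mono-≤ (layer-upClosed (up ∘ s⊆s) i (suc r) refl)
                                                     (+-mono-≤ (layer-upClosed (up ∘ s⊆s) (suc i) r (sym (+-suc i r)))
                                                               (layer-mono (out⇒in up) (suc i))) ⟩
  suc i * c + (suc (suc i) * e + c)                ≡⟨ shapeʳ i c e ⟩
  suc (suc i) * (c + e)                            ∎
  where
  open ≤-Reasoning
  a b c e : ℕ
  a = layer (p ∘ (inside ∷_)) i
  b = layer (p ∘ (outside ∷_)) (suc i)
  c = layer (p ∘ (inside ∷_)) (suc i)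
  e = layer (p ∘ (outside ∷_)) (suc (suc i))
  shapeˡ : ∀ r a b → suc r * (a + b) ≡ suc r * a + (r * b + b)
  shapeˡ = solve-∀
  shapeʳ : ∀ i c e → suc i * c + (suc (suc i) * e + c) ≡ suc (suc i) * (c + e)
  shapeʳ = solve-∀

-- Below the middle `suc i ≤ N ∸ i`, so the factors in the double count compare the right way.
layer-upClosed-mono : ∀ {N} {p : Subset N → Bool} → UpClosed p → ∀ i → i + i < N →
                      layer p i ≤ layer p (suc i)
layer-upClosed-mono {N} {p} up i 2i<N = *-cancelˡ-≤ (suc i) (begin
  suc i * layer p i        ≤⟨ *-monoˡ-≤ (layer p i) (m+n≤o⇒m≤o∸n (suc i) 2i<N) ⟩
  (N ∸ i) * layer p i      ≤⟨ layer-upClosed up i (N ∸ i) (m+[n∸m]≡n (m+n≤o⇒m≤o i (<⇒≤ 2i<N))) ⟩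
  suc i * layer p (suc i)  ∎)
  where open ≤-Reasoning

-- Binomial coefficients

-- The double count of `layer-upClosed` for the family of all sets, where it is exact; the induction
-- on Pascal's rule has the same shape.
C-absorption : ∀ N i r → i + r ≡ N → suc i * (N C suc i) ≡ r * (N C i)
C-absorption zero    zero    zero    refl = refl
C-absorption (suc N) zero    (suc r) refl = begin
  1 * (suc N C 1)       ≡⟨ cong (1 *_) (sym (nCk+nC[k+1]≡[n+1]C[k+1] N 0)) ⟩
  1 * (1 + N C 1)       ≡⟨ *-distribˡ-+ 1 1 (N C 1) ⟩
  1 + 1 * (N C 1)       ≡⟨ cong suc (C-absorption N zero r refl) ⟩
  1 + r * 1             ∎
  where open ≡-Reasoning
C-absorption (suc N) (suc i) zero eq =
  trans (cong (suc (suc i) *_) (k>n⇒nCk≡0 (≤-reflexive (cong suc (trans (sym eq) (+-identityʳ _))))))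
        (*-zeroʳ (suc (suc i)))
C-absorption (suc N) (suc i) (suc r) refl = begin
  suc (suc i) * (suc N C suc (suc i))  ≡⟨ cong (suc (suc i) *_) (sym (nCk+nC[k+1]≡[n+1]C[k+1] N (suc i))) ⟩
  suc (suc i) * (b + c)                ≡⟨ shapeˡ i b c ⟩
  suc i * b + (suc (suc i) * c + b)    ≡⟨ cong₂ (λ x y → x + (y + b)) (C-absorption N i (suc r) refl)
                                                (C-absorption N (suc i) r (sym (+-suc i r))) ⟩
  suc r * a + (r * b + b)              ≡⟨ shapeʳ r a b ⟩
  suc r * (a + b)                      ≡⟨ cong (suc r *_) (nCk+nC[k+1]≡[n+1]C[k+1] N i) ⟩
  suc r * (suc N C suc i)              ∎
  where
  open ≡-Reasoning
  a b c : ℕ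
  a = N C i
  b = N C suc i
  c = N C suc (suc i)
  shapeˡ : ∀ i b c → suc (suc i) * (b + c) ≡ suc i * b + (suc (suc i) * c + b)
  shapeˡ = solve-∀
  shapeʳ : ∀ r a b → suc r * a + (r * b + b) ≡ suc r * (a + b)
  shapeʳ = solve-∀

-- By absorption the ratio of the two coefficients is (N - i)/(i + 1), at most 1 in this range.
C-decreasing : ∀ N i → N ≤ suc (i + i) → N C suc i ≤ N C i
C-decreasing N i N≤ with ≤-total i N
... | inj₂ N≤i = ≤-trans (≤-reflexive (k>n⇒nCk≡0 (s≤s N≤i))) z≤n
... | inj₁ i≤N = *-cancelˡ-≤ (suc i) (begin
  suc i * (N C suc i)  ≡⟨ C-absorption N i (N ∸ i) (m+[n∸m]≡n i≤N) ⟩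
  (N ∸ i) * (N C i)    ≤⟨ *-monoˡ-≤ (N C i) (m≤n+o⇒m∸n≤o N i (≤-trans N≤ (≤-reflexive (sym (+-suc i i))))) ⟩
  suc i * (N C i)      ∎)
  where open ≤-Reasoning

-- Pascal's rule writes the right side as C(M, i - 1) + C(M, i), and from the middle on the first
-- summand is at least the second.
C-doubling : ∀ M i → suc M ≤ i + i → 2 * (M C i) ≤ suc M C i
C-doubling M (suc i) (s≤s M≤) = begin
  M C suc i + (M C suc i + 0)  ≡⟨ cong (M C suc i +_) (+-identityʳ _) ⟩
  M C suc i + M C suc i        ≤⟨ +-monoˡ-≤ _ (C-decreasing M i (≤-trans M≤ (≤-reflexive (+-suc i i)))) ⟩
  M C i + M C suc i            ≡⟨ nCk+nC[k+1]≡[n+1]C[k+1] M i ⟩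
  suc M C suc i                ∎
  where open ≤-Reasoning

-- Iterates `C-doubling` from row `M` to row `k + M`; the hypothesis on the last row is the
-- strictest.
C-doubling^ : ∀ k M i → k + M ≤ i + i → 2 ^ k * (M C i) ≤ (k + M) C i
C-doubling^ zero    M i _  = ≤-reflexive (+-identityʳ _)
C-doubling^ (suc k) M i le = begin
  2 * 2 ^ k * (M C i)    ≡⟨ *-assoc 2 (2 ^ k) _ ⟩
  2 * (2 ^ k * (M C i))  ≤⟨ *-monoʳ-≤ 2 (C-doubling^ k M i (<⇒≤ le)) ⟩
  2 * ((k + M) C i)      ≤⟨ C-doubling (k + M) i le ⟩
  suc (k + M) C i        ∎
  where open ≤-Reasoning

-- The relative gap 1 − C(N, i+1)/C(N, i) is least at i = N/2, where it equals 2/(N + 2).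
C-gap : ∀ N i b → N ≤ i + i → b * (N + 2) ≤ 2 * (N C i) → b + N C suc i ≤ N C i
C-gap N i b N≤ b≤ with ≤-<-connex i N
... | inj₂ N<i = begin
  b + N C suc i  ≡⟨ cong (b +_) (k>n⇒nCk≡0 (m<n⇒m<1+n N<i)) ⟩
  b + 0          ≡⟨ +-identityʳ b ⟩
  b              ≤⟨ m≤m*n b (2 + N) ⟩
  b * (2 + N)    ≡⟨ cong (b *_) (+-comm 2 N) ⟩
  b * (N + 2)    ≤⟨ b≤ ⟩
  2 * (N C i)    ≡⟨ cong (2 *_) (k>n⇒nCk≡0 N<i) ⟩
  0              ≤⟨ z≤n ⟩
  N C i          ∎
  where open ≤-Reasoning
... | inj₁ i≤N = *-cancelˡ-≤ (2 * suc i) (begin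
  2 * suc i * (b + N C suc i)                     ≡⟨ distrib i b (N C suc i) ⟩
  2 * suc i * b + 2 * (suc i * (N C suc i))       ≡⟨ cong (λ x → 2 * suc i * b + 2 * x) (C-absorption N i r i+r≡N) ⟩
  2 * suc i * b + 2 * (r * (N C i))               ≤⟨ +-monoˡ-≤ _ (*-monoˡ-≤ b slack) ⟩
  suc s * (N + 2) * b + 2 * (r * (N C i))         ≡⟨ cong (_+ 2 * (r * (N C i))) (assoc s N b) ⟩
  suc s * (b * (N + 2)) + 2 * (r * (N C i))       ≤⟨ +-monoˡ-≤ _ (*-monoʳ-≤ (suc s) b≤) ⟩
  suc s * (2 * (N C i)) + 2 * (r * (N C i))       ≡⟨ collect s r (N C i) ⟩
  2 * suc (r + s) * (N C i)                       ≡⟨ cong (λ x → 2 * suc x * (N C i)) r+s≡i ⟩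
  2 * suc i * (N C i)                             ∎)
  where
  open ≤-Reasoning
  r s : ℕ
  r = N ∸ i
  s = i ∸ r
  i+r≡N : i + r ≡ N
  i+r≡N = m+[n∸m]≡n i≤N
  r+s≡i : r + s ≡ i
  r+s≡i = m+[n∸m]≡n (m≤n+o⇒m∸n≤o N i N≤)
  -- The relative gap is 1 - r/(i + 1) = (s + 1)/(i + 1); this says that it is at least 2/(N + 2),
  -- with equality at `s = 0`.
  slack : 2 * suc i ≤ suc s * (N + 2)
  slack = begin
    2 * suc i                               ≡⟨ cong (λ x → 2 * suc x) (sym r+s≡i) ⟩
    2 * suc (r + s)                         ≤⟨ m≤m+n _ (s * (r + s + r + 1)) ⟩
    2 * suc (r + s) + s * (r + s + r + 1)   ≡⟨ expand r s ⟩
    suc s * (r + s + r + 2)                 ≡⟨ cong (λ x → suc s * (x + r + 2)) r+s≡i ⟩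
    suc s * (i + r + 2)                     ≡⟨ cong (λ x → suc s * (x + 2)) i+r≡N ⟩
    suc s * (N + 2)                         ∎
    where
    expand : ∀ r s → 2 * suc (r + s) + s * (r + s + r + 1) ≡ suc s * (r + s + r + 2)
    expand = solve-∀
  distrib : ∀ i b c → 2 * suc i * (b + c) ≡ 2 * suc i * b + 2 * (suc i * c)
  distrib = solve-∀
  assoc : ∀ s N b → suc s * (N + 2) * b ≡ suc s * (b * (N + 2))
  assoc = solve-∀
  collect : ∀ s r c → suc s * (2 * c) + 2 * (r * c) ≡ 2 * suc (r + s) * c
  collect = solve-∀

-- The binomial estimate for grids

-- Lengthening a side of at least 3 by one multiplies N(N + 2) by at most (4/3)² < 2. The added
-- polynomial is the difference of the two sides.
grid-growth : ∀ m t → m * (4 + t) * (m * (4 + t) + 2) ≤ 2 * (m * (3 + t) * (m * (3 + t) + 2))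
grid-growth m t = ≤-trans (m≤m+n _ (2 * m * m + 4 * m * m * t + m * m * t * t + 4 * m + 2 * m * t))
                          (≤-reflexive (expand m t))
  where
  expand : ∀ m t → m * (4 + t) * (m * (4 + t) + 2)
                   + (2 * m * m + 4 * m * m * t + m * m * t * t + 4 * m + 2 * m * t)
                 ≡ 2 * (m * (3 + t) * (m * (3 + t) + 2))
  expand = solve-∀

grid≤2^ : ∀ a b → (3 + a) * (5 + b) * ((3 + a) * (5 + b) + 2) ≤ 2 ^ ((3 + a) + (5 + b))
-- The 3 by 5 grid barely passes: 15 · 17 against 2⁸. The 4 by 4 grid fails, with 16 · 18 = 288.
grid≤2^ zero zero = ≤ᵇ⇒≤ 255 256 _
grid≤2^ zero (suc b) =
  ≤-trans (grid-growth 3 (2 + b)) (*-monoʳ-≤ 2 (grid≤2^ zero b))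
grid≤2^ (suc a) b = begin
  (4 + a) * n * ((4 + a) * n + 2)        ≡⟨ cong (λ x → x * (x + 2)) (*-comm (4 + a) n) ⟩
  n * (4 + a) * (n * (4 + a) + 2)        ≤⟨ grid-growth n a ⟩
  2 * (n * (3 + a) * (n * (3 + a) + 2))  ≡⟨ cong (λ x → 2 * (x * (x + 2))) (*-comm n (3 + a)) ⟩
  2 * ((3 + a) * n * ((3 + a) * n + 2))  ≤⟨ *-monoʳ-≤ 2 (grid≤2^ a b) ⟩
  2 ^ ((4 + a) + n)                      ∎
  where
  open ≤-Reasoning
  n : ℕ
  n = 5 + b

-- For b = N · C(M, i), the union bound on non-dominating sets, the inequality is the hypothesis on
-- `b` in `C-gap`.
Estimate : (N M i : ℕ) → Set
Estimate N M i = N ≤ i + i → N * (N + 2) * (M C i) ≤ 2 * (N C i)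

estimate? : ∀ N M i → Dec (Estimate N M i)
estimate? N M i = (N ≤? i + i) →-dec (N * (N + 2) * (M C i) ≤? 2 * (N C i))

-- C(M, i) vanishes beyond `M`, so only finitely many `i` need checking.
estimate-upTo : ∀ N M → (∀ {i} → i < suc M → Estimate N M i) → ∀ i → Estimate N M i
estimate-upTo N M estimate i N≤2i with <-≤-connex M i
... | inj₂ i≤M = estimate (s≤s i≤M) N≤2i
... | inj₁ M<i = begin
  N * (N + 2) * (M C i)  ≡⟨ cong (N * (N + 2) *_) (k>n⇒nCk≡0 M<i) ⟩
  N * (N + 2) * 0        ≡⟨ *-zeroʳ (N * (N + 2)) ⟩
  0                      ≤⟨ z≤n ⟩
  2 * (N C i)            ∎
  where open ≤-Reasoning

-- The sides are `suc m` and `suc n`, so `m * n` vertices avoid both the row and the column of a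
-- given one.
GridBound : ℕ → ℕ → Set
GridBound m n = ∀ i → Estimate (suc m * suc n) (m * n) i

gridBound-sym : ∀ m n → GridBound m n → GridBound n m
gridBound-sym m n bound i =
  subst₂ (λ N M → Estimate N M i) (*-comm (suc m) (suc n)) (*-comm m n) (bound i)

-- No `i` up to `m * n` reaches half of the grid, so the estimate is vacuous there.
gridBound-sparse : ∀ m n → m * n + m * n < suc m * suc n → GridBound m n
gridBound-sparse m n 2M<N = estimate-upTo _ (m * n) λ where
  (s≤s i≤M) N≤2i →
    contradiction (<-≤-trans 2M<N (≤-trans N≤2i (+-mono-≤ i≤M i≤M))) (<-irrefl refl)

gridBound-large : ∀ a b → GridBound (2 + a) (4 + b)
gridBound-large a b i N≤2i = begin
  N * (N + 2) * (M C i)  ≤⟨ *-monoˡ-≤ (M C i) (grid≤2^ a b) ⟩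
  2 * 2 ^ k * (M C i)    ≡⟨ *-assoc 2 (2 ^ k) (M C i) ⟩
  2 * (2 ^ k * (M C i))  ≤⟨ *-monoʳ-≤ 2 (C-doubling^ k M i (subst (_≤ i + i) (split a b) N≤2i)) ⟩
  2 * ((k + M) C i)      ≡⟨ cong (λ x → 2 * (x C i)) (sym (split a b)) ⟩
  2 * (N C i)            ∎
  where
  open ≤-Reasoning
  N M k : ℕ
  N = (3 + a) * (5 + b)
  M = (2 + a) * (4 + b)
  -- The size `N − M` of a closed neighbourhood, one less than the sum of the sides; the spare
  -- factor 2 of `grid≤2^` becomes the 2 in front of C(N, i).
  k = (2 + a) + (5 + b)
  split : ∀ a b → (3 + a) * (5 + b) ≡ (2 + a) + (5 + b) + (2 + a) * (4 + b)
  split = solve-∀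

-- In terms of sides: one of at most 2 is sparse, one of at least 5 with the other at least 3 is
-- large, and the 3 by 3, 3 by 4 and 4 by 4 grids remain.
gridBound : ∀ m n → GridBound m n
gridBound 0 n = gridBound-sparse 0 n z<s
gridBound 1 n = gridBound-sparse 1 n (≤-trans (n≤1+n _) (≤-reflexive (width n)))
  where
  width : ∀ n → 2 + (1 * n + 1 * n) ≡ 2 * suc n
  width = solve-∀
gridBound m@(suc (suc _)) 0 = gridBound-sym 0 m (gridBound 0 m)
gridBound m@(suc (suc _)) 1 = gridBound-sym 1 m (gridBound 1 m)
gridBound (suc (suc a)) (suc (suc (suc (suc b)))) = gridBound-large a b
gridBound m@(suc (suc (suc (suc a)))) n@(suc (suc b)) = gridBound-sym n m (gridBound-large b a)
-- The numbers are `N`, `M` and `suc M`, as `allUpTo?` tests strictly below its bound.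
gridBound 2 2 = estimate-upTo 9 4 (toWitness {a? = allUpTo? (estimate? 9 4) 5} _)
gridBound 2 3 = estimate-upTo 12 6 (toWitness {a? = allUpTo? (estimate? 12 6) 7} _)
gridBound 3 2 = estimate-upTo 12 6 (toWitness {a? = allUpTo? (estimate? 12 6) 7} _)
gridBound 3 3 = estimate-upTo 16 9 (toWitness {a? = allUpTo? (estimate? 16 9) 10} _)

-- Unimodality

module _ {N} (G : Graph N) where

  d≡layer : ∀ i → d G i ≡ layer (isDominating G) i
  d≡layer = length-filterᵇ-layer N (isDominating G)

  isDominating-upClosed : UpClosed (isDominating G)
  isDominating-upClosed {U} {V} U⊆V t = from (isDominating-⇔ G V)
    (λ v → Dominates-mono G U⊆V (to (isDominating-⇔ G U) t v))

  -- All that the argument takes from the rook graph: the vertices outside a closed neighbourhood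
  -- fit into a set of constant size `M`.
  module _ (far : Fin N → Subset N) {M} (∣far∣≡M : ∀ v → ∣ far v ∣ ≡ M)
           (far-complete : ∀ u v → u ≢ v → ¬ T (adj G u v) → u ∈ far v) where

    -- The existence of `v` is phrased as a Boolean disjunction, the form that `layer-any` bounds.
    nondominating⇒⊆far : ∀ U → T (not (isDominating G U)) →
                         T (any (λ v → isYes (U ⊆? far v)) (allFin N))
    nondominating⇒⊆far U t with undominated G U t
    ... | v , ¬dom = any⁺ (λ v → isYes (U ⊆? far v)) (lose (∈-allFin v) (fromWitness {a? = U ⊆? far v} U⊆far))
      where
      U⊆far : U ⊆ far v
      U⊆far {u} u∈U = far-complete u v
        (λ { refl → ¬dom (inj₁ u∈U) }) (λ e → ¬dom (inj₂ (u , u∈U , e)))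

    layer-nondominating : ∀ i → layer (not ∘ isDominating G) i ≤ N * (M C i)
    layer-nondominating i = begin
      layer (not ∘ isDominating G) i                                ≤⟨ layer-mono nondominating⇒⊆far i ⟩
      layer (λ U → any (λ v → isYes (U ⊆? far v)) (allFin N)) i      ≤⟨ layer-any (λ v U → isYes (U ⊆? far v)) i layer-far (allFin N) ⟩
      length (allFin N) * (M C i)                                   ≡⟨ cong (_* (M C i)) (length-tabulate {n = N} id) ⟩
      N * (M C i)                                                   ∎
      where
      open ≤-Reasoning
      layer-far : ∀ v → layer (λ U → isYes (U ⊆? far v)) i ≤ M C i
      layer-far v = subst (λ x → _ ≤ x C i) (∣far∣≡M v)
        (layer-⊆ (far v) (λ U → toWitness {a? = U ⊆? far v}) i)

    -- All sets of size `i + 1` are granted as dominating, so it suffices that the `b`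
    -- non-dominating sets of size `i` fit into the gap between the two binomials.
    d-decreasing : ∀ i → N ≤ i + i → Estimate N M i → d G (suc i) ≤ d G i
    d-decreasing i N≤2i estimate = +-cancelˡ-≤ b _ _ (begin
      b + d G (suc i)                          ≡⟨ cong (b +_) (d≡layer (suc i)) ⟩
      b + layer (isDominating G) (suc i)       ≤⟨ +-monoʳ-≤ b (layer≤C (isDominating G) (suc i)) ⟩
      b + N C suc i                            ≤⟨ C-gap N i b N≤2i b≤ ⟩
      N C i                                    ≡⟨ sym (layer-not (isDominating G) i) ⟩
      layer (isDominating G) i + b             ≡⟨ +-comm _ b ⟩
      b + layer (isDominating G) i             ≡⟨ cong (b +_) (sym (d≡layer i)) ⟩
      b + d G i                                ∎)
      where
      open ≤-Reasoning
      b : ℕ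
      b = layer (not ∘ isDominating G) i
      swap : ∀ N c → N * c * (N + 2) ≡ N * (N + 2) * c
      swap = solve-∀
      b≤ : b * (N + 2) ≤ 2 * (N C i)
      b≤ = begin
        b * (N + 2)             ≤⟨ *-monoˡ-≤ (N + 2) (layer-nondominating i) ⟩
        N * (M C i) * (N + 2)   ≡⟨ swap N (M C i) ⟩
        N * (N + 2) * (M C i)   ≤⟨ estimate N≤2i ⟩
        2 * (N C i)             ∎

    domPoly-unimodal : (∀ i → Estimate N M i) → DomPolyUnimodal G
    domPoly-unimodal estimate = ⌈ N /2⌉ , increasing , decreasing
      where
      open ≤-Reasoning
      increasing : ∀ i → i < ⌈ N /2⌉ → d G i ≤ d G (suc i)
      increasing i i<k = subst₂ _≤_ (sym (d≡layer i)) (sym (d≡layer (suc i)))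
        (layer-upClosed-mono isDominating-upClosed i (begin-strict
          -- `⌈ N /2⌉` exceeds `⌊ N /2⌋` by at most one, so `i` is at most `⌊ N /2⌋`.
          i + i                  <⟨ +-mono-<-≤ i<k (≤-pred (≤-trans i<k (⌊n/2⌋-mono (n≤1+n (suc N))))) ⟩
          ⌈ N /2⌉ + ⌊ N /2⌋      ≡⟨ +-comm ⌈ N /2⌉ _ ⟩
          ⌊ N /2⌋ + ⌈ N /2⌉      ≡⟨ ⌊n/2⌋+⌈n/2⌉≡n N ⟩
          N                      ∎))
      decreasing : ∀ i → ⌈ N /2⌉ ≤ i → d G (suc i) ≤ d G i
      decreasing i k≤i = d-decreasing i (begin
        N                      ≡⟨ sym (⌊n/2⌋+⌈n/2⌉≡n N) ⟩
        ⌊ N /2⌋ + ⌈ N /2⌉      ≤⟨ +-mono-≤ (≤-trans (⌊n/2⌋≤⌈n/2⌉ N) k≤i) k≤i ⟩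
        i + i                  ∎) (estimate i)

-- Rook graphs

-- The product set p × q, laid out row by row to agree with the numbering of `combine` and
-- `remQuot`.
_⊗_ : ∀ {m n} → Subset m → Subset n → Subset (m * n)
p ⊗ q = Vec.concat (Vec.map (λ s → if s then q else ⊥) p)

∣++∣ : ∀ {m n} (p : Subset m) (q : Subset n) → ∣ p Vec.++ q ∣ ≡ ∣ p ∣ + ∣ q ∣
∣++∣ []            q = refl
∣++∣ (inside ∷ p)  q = cong suc (∣++∣ p q)
∣++∣ (outside ∷ p) q = ∣++∣ p q

∣⊗∣ : ∀ {m n} (p : Subset m) (q : Subset n) → ∣ p ⊗ q ∣ ≡ ∣ p ∣ * ∣ q ∣
∣⊗∣ []            q = refl
∣⊗∣ (inside ∷ p)  q = trans (∣++∣ q (p ⊗ q)) (cong (∣ q ∣ +_) (∣⊗∣ p q))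
∣⊗∣ {n = n} (outside ∷ p) q = trans (∣++∣ {n} ⊥ (p ⊗ q)) (cong₂ _+_ (∣⊥∣≡0 n) (∣⊗∣ p q))

∈-⊗ : ∀ {m n} {p : Subset m} {q : Subset n} {g h} → g ∈ p → h ∈ q → combine g h ∈ p ⊗ q
∈-⊗ {p = p} {q} {g} {h} g∈p h∈q = lookup⇒[]= _ (p ⊗ q) (begin
  lookup (p ⊗ q) (combine g h)                     ≡⟨ lookup-concat rows g h ⟩
  lookup (lookup rows g) h                         ≡⟨ cong (λ r → lookup r h) (lookup-map g _ p) ⟩
  lookup (if lookup p g then q else ⊥) h           ≡⟨ cong (λ s → lookup (if s then q else ⊥) h) ([]=⇒lookup g∈p) ⟩
  lookup q h                                       ≡⟨ []=⇒lookup h∈q ⟩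
  inside                                           ∎)
  where
  open ≡-Reasoning
  rows : Vec.Vec (Subset _) _
  rows = Vec.map (λ s → if s then q else ⊥) p

∣∁⁅⁆∣ : ∀ {n} (g : Fin (suc n)) → ∣ ∁ ⁅ g ⁆ ∣ ≡ n
∣∁⁅⁆∣ {n} g = trans (∣∁p∣≡n∸∣p∣ ⁅ g ⁆) (cong (suc n ∸_) (∣⁅x⁆∣≡1 g))

∈-∁⁅⁆ : ∀ {n} {g g′ : Fin n} → g ≢ g′ → g ∈ ∁ ⁅ g′ ⁆
∈-∁⁅⁆ {g′ = g′} g≢g′ = x∉p⇒x∈∁p (g≢g′ ∘ x∈⁅y⁆⇒x≡y g′)

module _ (m n : ℕ) where

  row : Fin (m * n) → Fin m
  row = quotient n

  column : Fin (m * n) → Fin n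
  column = remainder {m} n

  row-column-injective : ∀ {u v} → row u ≡ row v → column u ≡ column v → u ≡ v
  row-column-injective {u} {v} eqʳ eqᶜ =
    trans (sym (combine-remQuot {m} n u)) (trans (cong₂ combine eqʳ eqᶜ) (combine-remQuot {m} n v))

  rook-far : Fin (m * n) → Subset (m * n)
  rook-far v = ∁ ⁅ row v ⁆ ⊗ ∁ ⁅ column v ⁆

  rook-far-complete : ∀ u v → u ≢ v → ¬ T (adj (K m □ K n) u v) → u ∈ rook-far v
  rook-far-complete u v u≢v ¬adj = subst (_∈ rook-far v) (combine-remQuot {m} n u)
    (uncurry ∈-⊗ (distinct ¬adj))
    where
    distinct : ¬ T (adj (K m □ K n) u v) → row u ∈ ∁ ⁅ row v ⁆ × column u ∈ ∁ ⁅ column v ⁆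
    -- Taking `¬adj` as an argument lets this split evaluate the adjacency in its type; it becomes
    -- `true` when exactly one coordinate agrees.
    distinct ¬adj with row u ≟ row v | column u ≟ column v
    ... | yes eqʳ | yes eqᶜ = contradiction (row-column-injective eqʳ eqᶜ) u≢v
    ... | yes _   | no _    = contradiction _ ¬adj
    ... | no _    | yes _   = contradiction _ ¬adj
    ... | no neʳ  | no neᶜ  = ∈-∁⁅⁆ neʳ , ∈-∁⁅⁆ neᶜ

theorem5p6 : (m n : ℕ) → DomPolyUnimodal (K (suc m) □ K (suc n))
theorem5p6 m n = domPoly-unimodal (K (suc m) □ K (suc n)) (rook-far (suc m) (suc n))
  -- One row and one column are removed, leaving `m` times `n` vertices.
  (λ v → trans (∣⊗∣ (∁ ⁅ row (suc m) (suc n) v ⁆) (∁ ⁅ column (suc m) (suc n) v ⁆))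
               (cong₂ _*_ (∣∁⁅⁆∣ (row (suc m) (suc n) v)) (∣∁⁅⁆∣ (column (suc m) (suc n) v))))
  (rook-far-complete (suc m) (suc n))
  (gridBound m n)
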